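{- Let $c\ge 3$ be an integer with distinct prime factors $q_1,\dots,q_\omega$. Then $$G_c \;=\; R(c)^{\varphi(c)/2}\prod_{\substack{2\le p<c,\ p \text{ prime}\\ (p,c)=1}} p^{E_c(p)}.$$
   Context: For a positive integer $n$, $R(n)$ denotes its radical, the product of the distinct primes dividing $n$ (with $R(1)=1$). $\varphi$ is Euler's totient function. For an integer $c\ge 3$, consider all pairs of positive integers $(a,b)$ with $a+b=c$, $a<b$, $\gcd(a,b)=1$; there are $\varphi(c)/2$ of them, and $G_c$ is the product of $R(abc)$ over all these pairs. For a positive integer $n$ with distinct prime factors $q_1,\dots,q_\omega$ ($\omega=0$ if $n=1$) and a real number $x\neq 0$, define $$E_n(x)=\sum_{S\subseteq\{1,\dots,\omega\}}(-1)^{|S|}\left\lfloor \frac{n}{x\prod_{i\in S}q_i}\right\rfloor,$$ i.e. $\lfloor n/x\rfloor-\sum_i\lfloor n/(xq_i)\rfloor+\sum_{i<j}\lfloor n/(xq_iq_j)\rfloor-\cdots+(-1)^\omega\lfloor n/(xq_1\cdots q_\omega)\rfloor$. -}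

module Defs where

open import Data.Fin.Subset using (Subset; inside; outside; ∣_∣)
open import Data.Integer.Base as ℤ using (ℤ; +_; -[1+_]; 0ℤ; -1ℤ)
open import Data.List.Base
  using (List; []; _∷_; _++_; map; foldr; filter; length; upTo; applyUpTo; cartesianProduct)
open import Data.Nat.Base using (ℕ; zero; suc; _+_; _*_; _^_; _/_; _≤_; _<_)
open import Data.Nat.Divisibility using (_∣?_)
open import Data.Nat.GCD using (gcd)
open import Data.Nat.ListAction using (product)
open import Data.Nat.Primality using (prime?)
open import Data.Nat.Properties using (_≟_; _≤?_; _<?_; m^n≢0)
open import Data.Product.Base using (_×_; _,_)
open import Data.Rational.Base as ℚ using (ℚ; 0ℚ; 1ℚ)
open import Data.Vec.Base using ([]; _∷_)
open import Relation.Binary.PropositionalEquality.Core using (_≡_)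
open import Relation.Nullary.Decidable using (Dec; _×-dec_)

φ : ℕ → ℕ
φ n = length (filter (λ k → gcd k n ≟ 1) (applyUpTo suc n))

-- In increasing order and without repetition, for n ≥ 1.
primeFactors : ℕ → List ℕ
primeFactors n = filter (λ p → prime? p ×-dec p ∣? n) (upTo (suc n))

R : ℕ → ℕ
R n = product (primeFactors n)

IsABC : ℕ → ℕ × ℕ → Set
IsABC c (a , b) = 1 ≤ a × 1 ≤ b × a + b ≡ c × a < b × gcd a b ≡ 1

isABC? : ∀ c ab → Dec (IsABC c ab)
isABC? c (a , b) =
  1 ≤? a ×-dec 1 ≤? b ×-dec a + b ≟ c ×-dec a <? b ×-dec gcd a b ≟ 1

-- Both members of a pair with sum c are at most c, so the search is exhaustive.
abcPairs : ℕ → List (ℕ × ℕ)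
abcPairs c = filter (isABC? c) (cartesianProduct (upTo (suc c)) (upTo (suc c)))

G : ℕ → ℕ
G c = product (map (λ (a , b) → R (a * b * c)) (abcPairs c))

allSubsets : ∀ n → List (Subset n)
allSubsets zero    = [] ∷ []
allSubsets (suc n) = map (outside ∷_) (allSubsets n) ++ map (inside ∷_) (allSubsets n)

-- The product of the entries of qs whose index lies in S.
∏[_∈_] : (qs : List ℕ) → Subset (length qs) → ℕ
∏[ []     ∈ []          ] = 1
∏[ q ∷ qs ∈ inside  ∷ S ] = q * ∏[ qs ∈ S ]
∏[ q ∷ qs ∈ outside ∷ S ] = ∏[ qs ∈ S ]

-- The value at d = 0 is a junk value, never reached below: there d is a
-- product of primes and of a nonzero x.
⌊_/_⌋ : ℕ → ℕ → ℕ
⌊ m / zero  ⌋ = 0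
⌊ m / suc d ⌋ = m / suc d

-- Restricted to natural x; meaningful for x ≠ 0.
E : ℕ → ℕ → ℤ
E n x = foldr ℤ._+_ 0ℤ (map term (allSubsets (length qs)))
  where
  qs : List ℕ
  qs = primeFactors n

  term : Subset (length qs) → ℤ
  term S = -1ℤ ℤ.^ ∣ S ∣ ℤ.* + ⌊ n / x * ∏[ qs ∈ S ] ⌋

fromℕ : ℕ → ℚ
fromℕ n = + n ℚ./ 1

-- E is an alternating sum in ℤ, so it is used as an integer exponent, with
-- values in ℚ.  A negative power of 0 is given the junk value 0.
_^ℤ_ : ℕ → ℤ → ℚ
m     ^ℤ (+ n)    = fromℕ (m ^ n)
zero  ^ℤ -[1+ n ] = 0ℚ
suc m ^ℤ -[1+ n ] = (+ 1 ℚ./ (suc m ^ suc n)) {{m^n≢0 (suc m) (suc n)}}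

coprimePrimesBelow : ℕ → List ℕ
coprimePrimesBelow c =
  filter (λ p → 2 ≤? p ×-dec prime? p ×-dec gcd p c ≟ 1) (upTo c)

∏ℚ : List ℚ → ℚ
∏ℚ = foldr ℚ._*_ 1ℚ

module Submission where

-- c is coprime to both members of each pair {a, b}, and the pairs partition the totatives
-- of c, so G_c is R(c)^(φ(c)/2) times the product of R(k) over the totatives k.  Exchanging
-- the products over k and over the primes dividing k, the exponent of p is the number of
-- multiples of p that are at most c and coprime to c, which inclusion–exclusion over the
-- prime factors of c identifies with E_c(p).

open import Defs
open import Algebra.Properties.CommutativeSemigroup using (interchange; x∙yz≈y∙xz)
open import Data.Fin.Subset using (Subset; inside; outside; ∣_∣)
open import Data.Integer.Base as ℤ using (ℤ; +_; 0ℤ; 1ℤ; -1ℤ)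
import Data.Integer.Properties as ℤ
open import Data.List.Base
  using (List; []; _∷_; _++_; map; foldr; filter; length; upTo; applyUpTo; cartesianProduct)
open import Data.List.Membership.Propositional using (_∈_)
open import Data.List.Membership.Propositional.Properties
  using ( ∈-filter⁺; ∈-filter⁻; ∈-upTo⁺; ∈-applyUpTo⁺; ∈-applyUpTo⁻; ∈-++⁺ˡ; ∈-++⁺ʳ; ∈-++⁻
        ; ∈-map⁺; ∈-map⁻; ∈-cartesianProduct⁺)
open import Data.List.Membership.Propositional.Properties.WithK using (unique∧set⇒bag)
open import Data.List.Properties
  using (map-cong; map-cong-local; map-∘; map-++; length-++; length-map; length-applyUpTo)
open import Data.List.Relation.Binary.BagAndSetEquality using (∼bag⇒↭)
open import Data.List.Relation.Binary.Disjoint.Propositional using (Disjoint)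
open import Data.List.Relation.Binary.Permutation.Propositional using (_↭_)
open import Data.List.Relation.Binary.Permutation.Propositional.Properties using (↭-length; map⁺)
open import Data.List.Relation.Unary.All as All using (All; []; _∷_; all?)
import Data.List.Relation.Unary.All.Properties as All
open import Data.List.Relation.Unary.AllPairs using ([]; _∷_)
open import Data.List.Relation.Unary.Any using (here; there)
open import Data.List.Relation.Unary.Unique.Propositional using (Unique)
import Data.List.Relation.Unary.Unique.Propositional.Properties as Unique
open import Data.Nat.Base as ℕ
  using ( ℕ; zero; suc; _≤_; _<_; _^_; _/_; _+_; _∸_; NonZero; z≤n; s≤s; >-nonZero; ≢-nonZero)
open import Data.Nat.Coprimality as Coprime
  using (Coprime; coprime-divisor; coprime⇒gcd≡1; gcd≡1⇒coprime)
open import Data.Nat.Divisibility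
open import Data.Nat.DivMod using (m*n/n≡m; m/n*n≤m; /-monoˡ-≤)
open import Data.Nat.GCD using (gcd)
open import Data.Nat.ListAction using (product)
open import Data.Nat.ListAction.Properties using (product-++; product-↭)
open import Data.Nat.Primality
  using (Prime; prime?; euclidsLemma; prime⇒irreducible; prime⇒nonZero; prime⇒nonTrivial; ¬prime[1])
open import Data.Nat.Primality.Factorisation using (factorise)
open import Data.Nat.Properties as ℕ using (_≟_)
open import Data.Product.Base using (_×_; _,_; proj₁; proj₂; ∃)
open import Data.Rational.Base using (_*_; toℚᵘ)
import Data.Rational.Properties as ℚ
open import Data.Rational.Unnormalised.Base as ℚᵘ using (ℚᵘ; mkℚᵘ; *≡*)
import Data.Rational.Unnormalised.Properties as ℚᵘ
open import Data.Sum.Base using (inj₁; inj₂)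
open import Data.Vec.Base renaming (_∷_ to _∷ᵥ_) using ()
open import Function.Base using (_∘_)
open import Function.Bundles using (mk⇔)
open import Relation.Binary.Definitions using (tri<; tri≈; tri>)
open import Relation.Binary.PropositionalEquality
  using (_≡_; _≢_; refl; sym; trans; cong; cong₂; subst; module ≡-Reasoning)
open import Relation.Nullary using (yes; no; contradiction)
open import Relation.Nullary.Decidable using (_×-dec_; ¬?)
open import Relation.Unary using (Decidable)

private
  variable
    A B : Set
    d m n p q c k : ℕ

-- Lists without repetition, products over lists, and the range from 1 to n.

-- In a list without repetition an element has at most one membership proof, so having the same
-- members already means having the same multiplicities. The counting and rearrangement arguments
-- below rest on this: each is reduced to two inclusions.
unique∧set⇒↭ : {xs ys : List A} → Unique xs → Unique ys →
               (∀ {x} → x ∈ xs → x ∈ ys) → (∀ {x} → x ∈ ys → x ∈ xs) → xs ↭ ys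
unique∧set⇒↭ xs! ys! ⊆ ⊇ = ∼bag⇒↭ (unique∧set⇒bag xs! ys! (mk⇔ ⊆ ⊇))

-- Injectivity is asked only on members because the projections from pairs are injective only among
-- pairs with a fixed sum.
map-unique : {f : A → B} {xs : List A} →
             (∀ {x y} → x ∈ xs → y ∈ xs → f x ≡ f y → x ≡ y) →
             Unique xs → Unique (map f xs)
map-unique {xs = []}     inj []         = []
map-unique {xs = x ∷ xs} inj (x∉ ∷ xs!) =
  All.map⁺ (All.tabulate λ y∈ eq → All.lookup x∉ y∈ (inj (here refl) (there y∈) eq))
  ∷ map-unique (λ x∈ y∈ → inj (there x∈) (there y∈)) xs!

product-map-* : (f g : A → ℕ) (xs : List A) →
  product (map (λ x → f x ℕ.* g x) xs) ≡ product (map f xs) ℕ.* product (map g xs)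
product-map-* f g []       = refl
product-map-* f g (x ∷ xs) = trans (cong (f x ℕ.* g x ℕ.*_) (product-map-* f g xs))
  (interchange ℕ.*-commutativeSemigroup (f x) (g x) _ _)

product-map-const : ∀ m (xs : List A) → product (map (λ _ → m) xs) ≡ m ^ length xs
product-map-const m []       = refl
product-map-const m (_ ∷ xs) = cong (m ℕ.*_) (product-map-const m xs)

range : ℕ → List ℕ
range = applyUpTo suc

range-unique : ∀ n → Unique (range n)
range-unique n = Unique.applyUpTo⁺₁ suc n λ i<j _ eq → ℕ.<⇒≢ i<j (ℕ.suc-injective eq)

∈-range⁺ : 1 ≤ k → k ≤ n → k ∈ range n
∈-range⁺ {suc k} _ k<n = ∈-applyUpTo⁺ suc k<n

∈-range⁻ : k ∈ range n → 1 ≤ k × k ≤ n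
∈-range⁻ k∈ with _ , i<n , refl ← ∈-applyUpTo⁻ suc k∈ = s≤s z≤n , i<n

-- Primes and coprimality.

prime∣prime⇒≡ : Prime p → Prime q → p ∣ q → p ≡ q
prime∣prime⇒≡ pp pq p∣q with prime⇒irreducible pq p∣q
... | inj₁ refl = contradiction pp ¬prime[1]
... | inj₂ p≡q  = p≡q

prime⇒∤coprime : Prime p → Coprime m n → p ∣ m → p ∤ n
prime⇒∤coprime pp m⊥n p∣m p∣n with refl ← m⊥n (p∣m , p∣n) = ¬prime[1] pp

∃-primeDivisor : ∀ n .{{_ : NonZero n}} → n ≢ 1 → ∃ λ p → Prime p × p ∣ n
∃-primeDivisor n n≢1 with factorise n
... | record { factors = []     ; isFactorisation = n≡1 } = contradiction n≡1 n≢1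
... | record { factors = p ∷ ps ; isFactorisation = n≡  ; factorsPrime = pp ∷ _ } =
  p , pp , subst (p ∣_) (sym n≡) (m∣m*n (product ps))

-- A common divisor other than 1 has a prime divisor unless it is 0, and 0 cannot divide the nonzero
-- `n`.
∤⇒coprime : .{{_ : NonZero n}} → (∀ {p} → Prime p → p ∣ n → p ∤ m) → Coprime m n
∤⇒coprime {n} h {d} (d∣m , d∣n) with d ≟ 1 | d ≟ 0
... | yes d≡1 | _        = d≡1
... | no  _   | yes refl = contradiction (0∣⇒≡0 d∣n) (ℕ.≢-nonZero⁻¹ n)
... | no  d≢1 | no  d≢0
  with p , pp , p∣d ← ∃-primeDivisor d {{≢-nonZero d≢0}} d≢1 =
  contradiction (∣-trans p∣d d∣m) (h pp (∣-trans p∣d d∣n))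

-- A common divisor `d` of `m * n` and `k` is itself coprime to `m`, since it divides `k`. Hence it
-- divides `n`, and `n` is coprime to `k`.
coprime-*ˡ : Coprime m k → Coprime n k → Coprime (m ℕ.* n) k
coprime-*ˡ m⊥k n⊥k {d} (d∣mn , d∣k) =
  n⊥k (coprime-divisor (λ (e∣d , e∣m) → m⊥k (e∣m , ∣-trans e∣d d∣k)) d∣mn , d∣k)

coprime-+ʳ : Coprime m n → Coprime m (m + n)
coprime-+ʳ m⊥n (d∣m , d∣m+n) = m⊥n (d∣m , ∣m+n∣m⇒∣n d∣m+n d∣m)

-- Prime factors and multiplicativity of the radical.

primeFactor? : ∀ n → Decidable (λ p → Prime p × p ∣ n)
primeFactor? n p = prime? p ×-dec p ∣? n

∈-primeFactors⁺ : .{{_ : NonZero n}} → Prime p → p ∣ n → p ∈ primeFactors n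
∈-primeFactors⁺ {n} pp p∣n =
  ∈-filter⁺ (primeFactor? n) (∈-upTo⁺ (s≤s (∣⇒≤ p∣n))) (pp , p∣n)

∈-primeFactors⁻ : ∀ n → p ∈ primeFactors n → Prime p × p ∣ n
∈-primeFactors⁻ n p∈ =
  proj₂ (∈-filter⁻ (primeFactor? n) {xs = upTo (suc n)} p∈)

primeFactors-unique : ∀ n → Unique (primeFactors n)
primeFactors-unique n =
  Unique.filter⁺ (primeFactor? n) (Unique.upTo⁺ (suc n))

-- Euclid's lemma gives equality of the underlying sets; coprimality ensures that the concatenation
-- repeats no prime.
primeFactors-* : ∀ m n .{{_ : NonZero m}} .{{_ : NonZero n}} → Coprime m n →
                 primeFactors (m ℕ.* n) ↭ primeFactors m ++ primeFactors n
primeFactors-* m n m⊥n = unique∧set⇒↭ (primeFactors-unique (m ℕ.* n))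
  (Unique.++⁺ (primeFactors-unique m) (primeFactors-unique n) disjoint) to from
  where
  instance
    mn≢0 : NonZero (m ℕ.* n)
    mn≢0 = ℕ.m*n≢0 m n

  disjoint : Disjoint (primeFactors m) (primeFactors n)
  disjoint (p∈m , p∈n) with pp , p∣m ← ∈-primeFactors⁻ m p∈m =
    prime⇒∤coprime pp m⊥n p∣m (proj₂ (∈-primeFactors⁻ n p∈n))

  to : ∀ {p} → p ∈ primeFactors (m ℕ.* n) → p ∈ primeFactors m ++ primeFactors n
  to p∈ with pp , p∣mn ← ∈-primeFactors⁻ (m ℕ.* n) p∈ with euclidsLemma m n pp p∣mn
  ... | inj₁ p∣m = ∈-++⁺ˡ (∈-primeFactors⁺ pp p∣m)
  ... | inj₂ p∣n = ∈-++⁺ʳ (primeFactors m) (∈-primeFactors⁺ pp p∣n)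

  from : ∀ {p} → p ∈ primeFactors m ++ primeFactors n → p ∈ primeFactors (m ℕ.* n)
  from p∈ with ∈-++⁻ (primeFactors m) p∈
  ... | inj₁ p∈m with pp , p∣m ← ∈-primeFactors⁻ m p∈m =
    ∈-primeFactors⁺ pp (∣m⇒∣m*n n p∣m)
  ... | inj₂ p∈n with pp , p∣n ← ∈-primeFactors⁻ n p∈n =
    ∈-primeFactors⁺ pp (∣n⇒∣m*n m p∣n)

R-* : ∀ m n .{{_ : NonZero m}} .{{_ : NonZero n}} → Coprime m n → R (m ℕ.* n) ≡ R m ℕ.* R n
R-* m n m⊥n = trans (product-↭ (primeFactors-* m n m⊥n)) (product-++ (primeFactors m) _)

-- Totatives of c and the pairs with sum c.

totatives : ℕ → List ℕ
totatives c = filter (λ k → gcd k c ≟ 1) (range c)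

∈-totatives⁺ : 1 ≤ k → k ≤ c → Coprime k c → k ∈ totatives c
∈-totatives⁺ {c = c} 1≤k k≤c k⊥c =
  ∈-filter⁺ (λ k → gcd k c ≟ 1) (∈-range⁺ 1≤k k≤c) (coprime⇒gcd≡1 k⊥c)

∈-totatives⁻ : ∀ c → k ∈ totatives c → 1 ≤ k × k ≤ c × Coprime k c
∈-totatives⁻ c k∈ with k∈r , g ← ∈-filter⁻ (λ k → gcd k c ≟ 1) {xs = range c} k∈
  with 1≤k , k≤c ← ∈-range⁻ k∈r = 1≤k , k≤c , gcd≡1⇒coprime g

totatives-unique : ∀ c → Unique (totatives c)
totatives-unique c = Unique.filter⁺ (λ k → gcd k c ≟ 1) (range-unique c)

-- If `k` were `c`, then `c` would be coprime to itself, hence equal to 1.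
∈-totatives⇒< : 2 ≤ c → k ∈ totatives c → k < c
∈-totatives⇒< {c} 2≤c k∈ with _ , k≤c , k⊥c ← ∈-totatives⁻ c k∈ =
  ℕ.≤∧≢⇒< k≤c λ { refl → ℕ.<⇒≢ 2≤c (sym (k⊥c (∣-refl , ∣-refl))) }

∈-abcPairs⁺ : ∀ {a b} → IsABC c (a , b) → (a , b) ∈ abcPairs c
∈-abcPairs⁺ {c} {a} {b} abc@(_ , _ , refl , _) =
  ∈-filter⁺ (isABC? c)
    (∈-cartesianProduct⁺ (∈-upTo⁺ (s≤s (ℕ.m≤m+n a b))) (∈-upTo⁺ (s≤s (ℕ.m≤n+m b a)))) abc

∈-abcPairs⁻ : ∀ c {ab} → ab ∈ abcPairs c → IsABC c ab
∈-abcPairs⁻ c ab∈ =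
  proj₂ (∈-filter⁻ (isABC? c) {xs = cartesianProduct (upTo (suc c)) (upTo (suc c))} ab∈)

abcPairs-unique : ∀ c → Unique (abcPairs c)
abcPairs-unique c =
  Unique.filter⁺ (isABC? c)
    (Unique.cartesianProduct⁺ (Unique.upTo⁺ (suc c)) (Unique.upTo⁺ (suc c)))

-- The pair k, c − k is never k, k: then k would divide c, forcing k = 1 and c = 2.
abcPairs-totatives : 3 ≤ c → map proj₁ (abcPairs c) ++ map proj₂ (abcPairs c) ↭ totatives c
abcPairs-totatives {c} 3≤c = unique∧set⇒↭
  (Unique.++⁺ (map-unique proj₁-injective (abcPairs-unique c))
              (map-unique proj₂-injective (abcPairs-unique c)) disjoint)
  (totatives-unique c) to from
  where
  proj₁-injective : ∀ {x y} → x ∈ abcPairs c → y ∈ abcPairs c → proj₁ x ≡ proj₁ y → x ≡ y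
  proj₁-injective {a , b} {a , b′} x∈ y∈ refl
    with _ , _ , e , _ ← ∈-abcPairs⁻ c x∈ | _ , _ , e′ , _ ← ∈-abcPairs⁻ c y∈ =
    cong (a ,_) (ℕ.+-cancelˡ-≡ a b b′ (trans e (sym e′)))

  proj₂-injective : ∀ {x y} → x ∈ abcPairs c → y ∈ abcPairs c → proj₂ x ≡ proj₂ y → x ≡ y
  proj₂-injective {a , b} {a′ , b} x∈ y∈ refl
    with _ , _ , e , _ ← ∈-abcPairs⁻ c x∈ | _ , _ , e′ , _ ← ∈-abcPairs⁻ c y∈ =
    cong (_, b) (ℕ.+-cancelʳ-≡ b a a′ (trans e (sym e′)))

  -- A common value `a` would be the smaller member of one pair and the larger member of another,
  -- yet its partner is `c - a` in both.
  disjoint : Disjoint (map proj₁ (abcPairs c)) (map proj₂ (abcPairs c))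
  disjoint (v∈₁ , v∈₂)
    with (a , b) , x∈ , refl ← ∈-map⁻ proj₁ v∈₁
    with (b′ , a) , y∈ , refl ← ∈-map⁻ proj₂ v∈₂
    with _ , _ , e , a<b , _ ← ∈-abcPairs⁻ c x∈ | _ , _ , e′ , b′<a , _ ← ∈-abcPairs⁻ c y∈ =
    ℕ.<-asym a<b (subst (_< a) b′≡b b′<a)
    where
    b′≡b : b′ ≡ b
    b′≡b = ℕ.+-cancelˡ-≡ a b′ b (trans (ℕ.+-comm a b′) (trans e′ (sym e)))

  to : ∀ {k} → k ∈ map proj₁ (abcPairs c) ++ map proj₂ (abcPairs c) → k ∈ totatives c
  to k∈ with ∈-++⁻ (map proj₁ (abcPairs c)) k∈
  ... | inj₁ k∈₁ with (a , b) , x∈ , refl ← ∈-map⁻ proj₁ k∈₁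
                 with 1≤a , _ , refl , _ , g ← ∈-abcPairs⁻ c x∈ =
    ∈-totatives⁺ 1≤a (ℕ.m≤m+n a b) (coprime-+ʳ (gcd≡1⇒coprime g))
  ... | inj₂ k∈₂ with (a , b) , x∈ , refl ← ∈-map⁻ proj₂ k∈₂
                 with _ , 1≤b , refl , _ , g ← ∈-abcPairs⁻ c x∈ =
    ∈-totatives⁺ 1≤b (ℕ.m≤n+m b a)
      (subst (Coprime b) (ℕ.+-comm b a) (coprime-+ʳ (Coprime.sym (gcd≡1⇒coprime g))))

  from : ∀ {k} → k ∈ totatives c → k ∈ map proj₁ (abcPairs c) ++ map proj₂ (abcPairs c)
  from {k} k∈ with 1≤k , k≤c , k⊥c ← ∈-totatives⁻ c k∈ = split (ℕ.<-cmp k l)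
    where
    l : ℕ
    l = c ∸ k

    k+l≡c : k + l ≡ c
    k+l≡c = ℕ.m+[n∸m]≡n k≤c

    1≤l : 1 ≤ l
    1≤l = ℕ.m<n⇒0<n∸m (∈-totatives⇒< (ℕ.≤-trans (ℕ.n≤1+n 2) 3≤c) k∈)

    k⊥l : Coprime k l
    k⊥l (d∣k , d∣l) = k⊥c (d∣k , subst (_ ∣_) k+l≡c (∣m∣n⇒∣m+n d∣k d∣l))

    split : _ → _
    split (tri< k<l _ _) = ∈-++⁺ˡ
      (∈-map⁺ proj₁ (∈-abcPairs⁺ (1≤k , 1≤l , k+l≡c , k<l , coprime⇒gcd≡1 k⊥l)))
    split (tri≈ _ k≡l _) with refl ← k⊥l (∣-refl , ∣-reflexive k≡l) =
      contradiction (trans (cong suc k≡l) k+l≡c) (ℕ.<⇒≢ 3≤c)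
    split (tri> _ _ l<k) = ∈-++⁺ʳ (map proj₁ (abcPairs c))
      (∈-map⁺ proj₂ (∈-abcPairs⁺
        (1≤l , 1≤k , trans (ℕ.+-comm l k) k+l≡c , l<k , coprime⇒gcd≡1 (Coprime.sym k⊥l))))

-- `φ c` is by definition the length of `totatives c`, which splits into equally many smaller and
-- larger members. The truncating division by 2 is therefore exact.
φ/2≡length-abcPairs : 3 ≤ c → φ c / 2 ≡ length (abcPairs c)
φ/2≡length-abcPairs {c} 3≤c = begin
  φ c / 2                     ≡⟨ cong (_/ 2) (↭-length (abcPairs-totatives 3≤c)) ⟨
  length (as ++ bs) / 2       ≡⟨ cong (_/ 2) (length-++ as) ⟩
  (length as + length bs) / 2
    ≡⟨ cong (_/ 2) (cong₂ _+_ (length-map proj₁ ps) (length-map proj₂ ps)) ⟩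
  -- `2 * l` unfolds to `l + (l + 0)`.
  (l + l) / 2                 ≡⟨ cong (λ m → (l + m) / 2) (ℕ.+-identityʳ l) ⟨
  2 ℕ.* l / 2                 ≡⟨ cong (_/ 2) (ℕ.*-comm 2 l) ⟩
  l ℕ.* 2 / 2                 ≡⟨ m*n/n≡m l 2 ⟩
  l                           ∎
  where
  open ≡-Reasoning
  ps : List (ℕ × ℕ)
  ps = abcPairs c
  as bs : List ℕ
  as = map proj₁ ps
  bs = map proj₂ ps
  l : ℕ
  l = length ps

-- The numbers `a`, `b` and `a + b` are pairwise coprime: a divisor shared by the sum and one
-- summand also divides the other summand.
R-abc : ∀ {a b} → IsABC c (a , b) → R (a ℕ.* b ℕ.* c) ≡ R a ℕ.* R b ℕ.* R c
R-abc {a = a} {b} (1≤a , 1≤b , refl , _ , g) =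
  trans (R-* (a ℕ.* b) (a + b) (coprime-*ˡ (coprime-+ʳ a⊥b) b⊥c))
        (cong (ℕ._* R (a + b)) (R-* a b a⊥b))
  where
  a⊥b : Coprime a b
  a⊥b = gcd≡1⇒coprime g
  b⊥c : Coprime b (a + b)
  b⊥c = subst (Coprime b) (ℕ.+-comm b a) (coprime-+ʳ (Coprime.sym a⊥b))
  instance
    a≢0 : NonZero a
    a≢0 = >-nonZero 1≤a
    b≢0 : NonZero b
    b≢0 = >-nonZero 1≤b
    ab≢0 : NonZero (a ℕ.* b)
    ab≢0 = ℕ.m*n≢0 a b
    c≢0 : NonZero (a + b)
    c≢0 = >-nonZero (ℕ.≤-trans 1≤a (ℕ.m≤m+n a b))

G≡∏R : 3 ≤ c → G c ≡ R c ^ (φ c / 2) ℕ.* product (map R (totatives c))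
G≡∏R {c} 3≤c = begin
  G c
    ≡⟨ cong product (map-cong-local {xs = ps} (All.tabulate λ ab∈ → R-abc (∈-abcPairs⁻ c ab∈))) ⟩
  product (map (λ (a , b) → R a ℕ.* R b ℕ.* R c) ps)
    ≡⟨ product-map-* (λ (a , b) → R a ℕ.* R b) (λ _ → R c) ps ⟩
  product (map (λ (a , b) → R a ℕ.* R b) ps) ℕ.* product (map (λ _ → R c) ps)
    ≡⟨ cong₂ ℕ._*_ ∏RaRb
         (trans (product-map-const (R c) ps) (cong (R c ^_) (sym (φ/2≡length-abcPairs 3≤c)))) ⟩
  product (map R (totatives c)) ℕ.* R c ^ (φ c / 2)
    ≡⟨ ℕ.*-comm (product (map R (totatives c))) _ ⟩
  R c ^ (φ c / 2) ℕ.* product (map R (totatives c)) ∎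
  where
  open ≡-Reasoning
  ps : List (ℕ × ℕ)
  ps = abcPairs c
  as bs : List ℕ
  as = map proj₁ ps
  bs = map proj₂ ps

  ∏RaRb : product (map (λ (a , b) → R a ℕ.* R b) ps) ≡ product (map R (totatives c))
  ∏RaRb = begin
    product (map (λ (a , b) → R a ℕ.* R b) ps)
      ≡⟨ product-map-* (R ∘ proj₁) (R ∘ proj₂) ps ⟩
    product (map (R ∘ proj₁) ps) ℕ.* product (map (R ∘ proj₂) ps)
      ≡⟨ cong₂ (λ xs ys → product xs ℕ.* product ys) (map-∘ ps) (map-∘ ps) ⟩
    product (map R as) ℕ.* product (map R bs)
      ≡⟨ product-++ (map R as) (map R bs) ⟨
    product (map R as ++ map R bs)
      ≡⟨ cong product (map-++ R as bs) ⟨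
    product (map R (as ++ bs))
      ≡⟨ product-↭ (map⁺ R (abcPairs-totatives 3≤c)) ⟩
    product (map R (totatives c)) ∎

-- Exchanging the products over totatives and over primes.

∏-filter-∣ : ∀ a as ps →
  product (filter (_∣? a) ps) ℕ.* product (map (λ p → p ^ length (filter (p ∣?_) as)) ps)
    ≡ product (map (λ p → p ^ length (filter (p ∣?_) (a ∷ as))) ps)
∏-filter-∣ a as []       = refl
-- The two kinds of filter branch on the same decision `p ∣? a`, so one case split reduces both
-- sides: the factor `p` gained on the left is the rise by one of its exponent on the right.
∏-filter-∣ a as (p ∷ ps) with ih ← ∏-filter-∣ a as ps | p ∣? a
... | yes _ = trans (interchange ℕ.*-commutativeSemigroup p r (p ^ l) _)
                    (cong (p ℕ.* p ^ l ℕ.*_) ih)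
  where
  r l : ℕ
  r = product (filter (_∣? a) ps)
  l = length (filter (p ∣?_) as)
... | no _  = trans (x∙yz≈y∙xz ℕ.*-commutativeSemigroup r (p ^ l) _)
                    (cong (p ^ l ℕ.*_) ih)
  where
  r l : ℕ
  r = product (filter (_∣? a) ps)
  l = length (filter (p ∣?_) as)

-- Double counting: both sides multiply together one factor `p` for each incidence `p ∣ a`.
∏-exchange : ∀ as ps →
  product (map (λ a → product (filter (_∣? a) ps)) as)
    ≡ product (map (λ p → p ^ length (filter (p ∣?_) as)) ps)
∏-exchange []       ps = sym (trans (product-map-const 1 ps) (ℕ.^-zeroˡ (length ps)))
∏-exchange (a ∷ as) ps =
  trans (cong (product (filter (_∣? a) ps) ℕ.*_) (∏-exchange as ps)) (∏-filter-∣ a as ps)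

coprimePrime? : ∀ c → Decidable (λ p → 2 ≤ p × Prime p × gcd p c ≡ 1)
coprimePrime? c p = 2 ℕ.≤? p ×-dec prime? p ×-dec gcd p c ≟ 1

∈-coprimePrimesBelow⁺ : Prime p → p < c → Coprime p c → p ∈ coprimePrimesBelow c
∈-coprimePrimesBelow⁺ {c = c} pp p<c p⊥c =
  ∈-filter⁺ (coprimePrime? c) (∈-upTo⁺ p<c)
    (ℕ.nonTrivial⇒n>1 _ {{prime⇒nonTrivial pp}} , pp , coprime⇒gcd≡1 p⊥c)

∈-coprimePrimesBelow⁻ : ∀ c → p ∈ coprimePrimesBelow c → Prime p × Coprime p c
∈-coprimePrimesBelow⁻ c p∈
  with _ , _ , pp , g ← ∈-filter⁻ (coprimePrime? c) {xs = upTo c} p∈ =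
  pp , gcd≡1⇒coprime g

coprimePrimesBelow-unique : ∀ c → Unique (coprimePrimesBelow c)
coprimePrimesBelow-unique c =
  Unique.filter⁺ (coprimePrime? c) (Unique.upTo⁺ c)

-- A prime `p` dividing `k` satisfies `p ≤ k < c` and inherits coprimality to `c` from `k`. All the
-- radicals are thus products over sublists of one fixed list, as `∏-exchange` requires.
primeFactors-totative : 2 ≤ c → k ∈ totatives c →
                        primeFactors k ↭ filter (_∣? k) (coprimePrimesBelow c)
primeFactors-totative {c} {k} 2≤c k∈ with 1≤k , _ , k⊥c ← ∈-totatives⁻ c k∈ =
  unique∧set⇒↭ (primeFactors-unique k)
    (Unique.filter⁺ (_∣? k) (coprimePrimesBelow-unique c)) to from
  where
  instance
    k≢0 : NonZero k
    k≢0 = >-nonZero 1≤k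

  to : ∀ {p} → p ∈ primeFactors k → p ∈ filter (_∣? k) (coprimePrimesBelow c)
  to p∈ with pp , p∣k ← ∈-primeFactors⁻ k p∈ =
    ∈-filter⁺ (_∣? k)
      (∈-coprimePrimesBelow⁺ pp (ℕ.≤-<-trans (∣⇒≤ p∣k) (∈-totatives⇒< 2≤c k∈))
        (λ (d∣p , d∣c) → k⊥c (∣-trans d∣p p∣k , d∣c)))
      p∣k

  from : ∀ {p} → p ∈ filter (_∣? k) (coprimePrimesBelow c) → p ∈ primeFactors k
  from p∈ with p∈c , p∣k ← ∈-filter⁻ (_∣? k) {xs = coprimePrimesBelow c} p∈ =
    ∈-primeFactors⁺ (proj₁ (∈-coprimePrimesBelow⁻ c p∈c)) p∣k

∏R≡∏^ : 2 ≤ c → product (map R (totatives c))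
  ≡ product (map (λ p → p ^ length (filter (p ∣?_) (totatives c))) (coprimePrimesBelow c))
∏R≡∏^ {c} 2≤c = trans
  (cong product (map-cong-local {xs = totatives c}
    (All.tabulate λ k∈ → product-↭ (primeFactors-totative 2≤c k∈))))
  (∏-exchange (totatives c) (coprimePrimesBelow c))

-- Counting multiples of d that avoid a list of primes.

Sifted : ℕ → List ℕ → ℕ → Set
Sifted d qs k = d ∣ k × All (_∤ k) qs

sifted? : ∀ d qs → Decidable (Sifted d qs)
sifted? d qs k = d ∣? k ×-dec all? (λ q → ¬? (q ∣? k)) qs

-- The divisor `d` is a parameter beside `qs` so that the family is closed under the recursion of
-- `sieve-∷`, which moves a prime from `qs` into `d`.
sieve : ℕ → List ℕ → ℕ → List ℕ
sieve d qs n = filter (sifted? d qs) (range n)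

∈-sieve⁺ : ∀ {qs} → k ∈ range n → Sifted d qs k → k ∈ sieve d qs n
∈-sieve⁺ {d = d} {qs} = ∈-filter⁺ (sifted? d qs)

∈-sieve⁻ : ∀ d qs n → k ∈ sieve d qs n → k ∈ range n × Sifted d qs k
∈-sieve⁻ d qs n = ∈-filter⁻ (sifted? d qs) {xs = range n}

sieve-unique : ∀ d qs n → Unique (sieve d qs n)
sieve-unique d qs n = Unique.filter⁺ (sifted? d qs) (range-unique n)

-- With no primes to avoid, what remains is `d`, `2d`, ..., up to the last multiple not exceeding
-- `n`, so there are `n / d` of them.
sieve-[] : ∀ d n .{{_ : NonZero d}} → sieve d [] n ↭ applyUpTo (λ i → suc i ℕ.* d) (n / d)
sieve-[] d n = unique∧set⇒↭ (sieve-unique d [] n)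
  (Unique.applyUpTo⁺₁ f (n / d) λ {i} {j} i<j _ eq →
    ℕ.<⇒≢ i<j (ℕ.suc-injective (ℕ.*-cancelʳ-≡ (suc i) (suc j) d eq)))
  to from
  where
  f : ℕ → ℕ
  f i = suc i ℕ.* d

  to : ∀ {k} → k ∈ sieve d [] n → k ∈ applyUpTo f (n / d)
  to k∈ with k∈r , d∣k , _ ← ∈-sieve⁻ d [] n k∈ with ∈-range⁻ k∈r | d∣k
  -- The multiple 0 is excluded because the range starts at 1.
  ... | ()      , _   | divides-refl zero
  ... | _       , k≤n | divides-refl (suc i) =
    ∈-applyUpTo⁺ f (subst (_≤ n / d) (m*n/n≡m (suc i) d) (/-monoˡ-≤ d k≤n))

  from : ∀ {k} → k ∈ applyUpTo f (n / d) → k ∈ sieve d [] n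
  from k∈ with i , i<n/d , refl ← ∈-applyUpTo⁻ f k∈ =
    ∈-sieve⁺ {d = d} {[]} (∈-range⁺ (ℕ.≤-trans (ℕ.>-nonZero⁻¹ d) (ℕ.m≤m+n d (i ℕ.* d)))
                        (ℕ.≤-trans (ℕ.*-monoˡ-≤ d i<n/d) (m/n*n≤m n d)))
             (n∣m*n (suc i) , [])

prime∤∧∣⇒*∣ : Prime q → q ∤ d → d ∣ k → q ∣ k → d ℕ.* q ∣ k
prime∤∧∣⇒*∣ {q} {d} pq q∤d (divides-refl m) q∣md with euclidsLemma m d pq q∣md
... | inj₁ q∣m = subst (_∣ m ℕ.* d) (ℕ.*-comm q d) (*-monoˡ-∣ d q∣m)
... | inj₂ q∣d = contradiction q∣d q∤d

-- Split by whether `q` divides `k`. Among multiples of `d`, with `q` a prime not dividing `d`,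
-- divisibility by `q` amounts to divisibility by `d * q`.
sieve-∷ : ∀ n {qs} → Prime q → q ∤ d →
          sieve d qs n ↭ sieve d (q ∷ qs) n ++ sieve (d ℕ.* q) qs n
sieve-∷ {q} {d} n {qs} pq q∤d = unique∧set⇒↭ (sieve-unique d qs n)
  (Unique.++⁺ (sieve-unique d (q ∷ qs) n) (sieve-unique (d ℕ.* q) qs n) disjoint) to from
  where
  disjoint : Disjoint (sieve d (q ∷ qs) n) (sieve (d ℕ.* q) qs n)
  disjoint (k∈₁ , k∈₂)
    with _ , _ , q∤k ∷ _ ← ∈-sieve⁻ d (q ∷ qs) n k∈₁
       | _ , dq∣k , _ ← ∈-sieve⁻ (d ℕ.* q) qs n k∈₂ = q∤k (m*n∣⇒n∣ d q dq∣k)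

  to : ∀ {k} → k ∈ sieve d qs n → k ∈ sieve d (q ∷ qs) n ++ sieve (d ℕ.* q) qs n
  to {k} k∈ with k∈r , d∣k , qs∤k ← ∈-sieve⁻ d qs n k∈ with q ∣? k
  ... | yes q∣k = ∈-++⁺ʳ (sieve d (q ∷ qs) n) (∈-sieve⁺ k∈r (prime∤∧∣⇒*∣ pq q∤d d∣k q∣k , qs∤k))
  ... | no  q∤k = ∈-++⁺ˡ (∈-sieve⁺ k∈r (d∣k , q∤k ∷ qs∤k))

  from : ∀ {k} → k ∈ sieve d (q ∷ qs) n ++ sieve (d ℕ.* q) qs n → k ∈ sieve d qs n
  from k∈ with ∈-++⁻ (sieve d (q ∷ qs) n) k∈
  ... | inj₁ k∈₁ with k∈r , d∣k , _ ∷ qs∤k ← ∈-sieve⁻ d (q ∷ qs) n k∈₁ =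
    ∈-sieve⁺ k∈r (d∣k , qs∤k)
  ... | inj₂ k∈₂ with k∈r , dq∣k , qs∤k ← ∈-sieve⁻ (d ℕ.* q) qs n k∈₂ =
    ∈-sieve⁺ k∈r (m*n∣⇒m∣ d q dq∣k , qs∤k)

-- Alternating sums and inclusion-exclusion.

∑ : List ℤ → ℤ
∑ = foldr ℤ._+_ 0ℤ

∑-++ : ∀ is js → ∑ (is ++ js) ≡ ∑ is ℤ.+ ∑ js
∑-++ []       js = sym (ℤ.+-identityˡ (∑ js))
∑-++ (i ∷ is) js = trans (cong (ℤ._+_ i) (∑-++ is js)) (sym (ℤ.+-assoc i (∑ is) (∑ js)))

∑-map-*ˡ : ∀ i (f : A → ℤ) xs → ∑ (map (λ x → i ℤ.* f x) xs) ≡ i ℤ.* ∑ (map f xs)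
∑-map-*ˡ i f []       = sym (ℤ.*-zeroʳ i)
∑-map-*ˡ i f (x ∷ xs) =
  trans (cong (ℤ._+_ (i ℤ.* f x)) (∑-map-*ˡ i f xs)) (sym (ℤ.*-distribˡ-+ i (f x) _))

-- The summand of `E` with an arbitrary list of primes and an arbitrary divisor, to allow induction;
-- `E c p` unfolds to `altSum (primeFactors c) c p`.
altTerm : ∀ qs → ℕ → ℕ → Subset (length qs) → ℤ
altTerm qs n d S = -1ℤ ℤ.^ ∣ S ∣ ℤ.* + ⌊ n / d ℕ.* ∏[ qs ∈ S ] ⌋

altSum : List ℕ → ℕ → ℕ → ℤ
altSum qs n d = ∑ (map (altTerm qs n d) (allSubsets (length qs)))

-- Subsets without `q` give the first sum. Those with `q` carry one more sign and a factor `q` in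
-- the denominator, which is absorbed into `d`.
altSum-∷ : ∀ q qs n d → altSum (q ∷ qs) n d ≡ altSum qs n d ℤ.+ -1ℤ ℤ.* altSum qs n (d ℕ.* q)
altSum-∷ q qs n d = begin
  ∑ (map t (map (outside ∷ᵥ_) Ss ++ map (inside ∷ᵥ_) Ss))
    ≡⟨ cong ∑ (map-++ t (map (outside ∷ᵥ_) Ss) (map (inside ∷ᵥ_) Ss)) ⟩
  ∑ (map t (map (outside ∷ᵥ_) Ss) ++ map t (map (inside ∷ᵥ_) Ss))
    ≡⟨ ∑-++ (map t (map (outside ∷ᵥ_) Ss)) _ ⟩
  ∑ (map t (map (outside ∷ᵥ_) Ss)) ℤ.+ ∑ (map t (map (inside ∷ᵥ_) Ss))
    ≡⟨ cong₂ (λ is js → ∑ is ℤ.+ ∑ js) (map-∘ Ss) (map-∘ Ss) ⟨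
  -- `altTerm` at `outside ∷ S` reduces to `altTerm` at `S`, so the first half is already
  -- `altSum qs n d`.
  altSum qs n d ℤ.+ ∑ (map (t ∘ (inside ∷ᵥ_)) Ss)
    ≡⟨ cong (λ is → altSum qs n d ℤ.+ ∑ is) (map-cong term-inside Ss) ⟩
  altSum qs n d ℤ.+ ∑ (map (λ S → -1ℤ ℤ.* altTerm qs n (d ℕ.* q) S) Ss)
    ≡⟨ cong (ℤ._+_ (altSum qs n d)) (∑-map-*ˡ -1ℤ (altTerm qs n (d ℕ.* q)) Ss) ⟩
  altSum qs n d ℤ.+ -1ℤ ℤ.* altSum qs n (d ℕ.* q) ∎
  where
  open ≡-Reasoning

  t : Subset (suc (length qs)) → ℤ
  t = altTerm (q ∷ qs) n d

  Ss : List (Subset (length qs))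
  Ss = allSubsets (length qs)

  term-inside : ∀ S → t (inside ∷ᵥ S) ≡ -1ℤ ℤ.* altTerm qs n (d ℕ.* q) S
  term-inside S = trans
    (ℤ.*-assoc -1ℤ (-1ℤ ℤ.^ ∣ S ∣) _)
    (cong (λ m → -1ℤ ℤ.* (-1ℤ ℤ.^ ∣ S ∣ ℤ.* + ⌊ n / m ⌋)) (sym (ℕ.*-assoc d q ∏[ qs ∈ S ])))

⌊/⌋≡/ : ∀ m d .{{_ : NonZero d}} → ⌊ m / d ⌋ ≡ m / d
⌊/⌋≡/ m (suc d) = refl

altSum-[] : ∀ n d .{{_ : NonZero d}} → altSum [] n d ≡ + length (sieve d [] n)
altSum-[] n d = begin
  (1ℤ ℤ.* + ⌊ n / d ℕ.* 1 ⌋) ℤ.+ 0ℤ ≡⟨ ℤ.+-identityʳ _ ⟩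
  1ℤ ℤ.* + ⌊ n / d ℕ.* 1 ⌋          ≡⟨ ℤ.*-identityˡ _ ⟩
  + ⌊ n / d ℕ.* 1 ⌋                   ≡⟨ cong (λ m → + ⌊ n / m ⌋) (ℕ.*-identityʳ d) ⟩
  + ⌊ n / d ⌋                         ≡⟨ cong +_ (⌊/⌋≡/ n d) ⟩
  + (n / d)                           ≡⟨ cong +_ (length-applyUpTo _ (n / d)) ⟨
  + length (applyUpTo _ (n / d))      ≡⟨ cong +_ (↭-length (sieve-[] d n)) ⟨
  + length (sieve d [] n)             ∎
  where open ≡-Reasoning

-- Inclusion-exclusion by induction on `qs` with `d` varying: `altSum-∷` subtracts exactly the part
-- that `sieve-∷` splits off.
altSum≡length-sieve : ∀ qs n d .{{_ : NonZero d}} → Unique qs → All Prime qs → All (_∤ d) qs →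
                      altSum qs n d ≡ + length (sieve d qs n)
altSum≡length-sieve []       n d _          _          _            = altSum-[] n d
altSum≡length-sieve (q ∷ qs) n d (q∉ ∷ qs!) (pq ∷ pqs) (q∤d ∷ qs∤d) = begin
  altSum (q ∷ qs) n d
    ≡⟨ altSum-∷ q qs n d ⟩
  altSum qs n d ℤ.+ -1ℤ ℤ.* altSum qs n (d ℕ.* q)
    ≡⟨ cong₂ (λ i j → i ℤ.+ -1ℤ ℤ.* j)
         (altSum≡length-sieve qs n d qs! pqs qs∤d)
         (altSum≡length-sieve qs n (d ℕ.* q) qs! pqs (All.tabulate ∤dq)) ⟩
  + length (sieve d qs n) ℤ.+ -1ℤ ℤ.* + z
    ≡⟨ cong₂ (λ l i → + l ℤ.+ i)
         (trans (↭-length (sieve-∷ n pq q∤d)) (length-++ (sieve d (q ∷ qs) n)))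
         (ℤ.-1*i≡-i (+ z)) ⟩
  + (y + z) ℤ.- + z
    ≡⟨ ℤ.+-assoc (+ y) (+ z) (ℤ.- (+ z)) ⟩
  + y ℤ.+ (+ z ℤ.- + z)
    ≡⟨ cong (ℤ._+_ (+ y)) (ℤ.+-inverseʳ (+ z)) ⟩
  + y ℤ.+ 0ℤ
    ≡⟨ ℤ.+-identityʳ (+ y) ⟩
  + y ∎
  where
  open ≡-Reasoning
  y z : ℕ
  y = length (sieve d (q ∷ qs) n)
  z = length (sieve (d ℕ.* q) qs n)

  instance
    q≢0 : NonZero q
    q≢0 = prime⇒nonZero pq
    dq≢0 : NonZero (d ℕ.* q)
    dq≢0 = ℕ.m*n≢0 d q

  -- The invariant survives the passage from `d` to `d * q`: a remaining prime dividing `q` would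
  -- equal `q`, against the distinctness of the list.
  ∤dq : ∀ {r} → r ∈ qs → r ∤ d ℕ.* q
  ∤dq r∈ r∣dq with euclidsLemma d q (All.lookup pqs r∈) r∣dq
  ... | inj₁ r∣d = All.lookup qs∤d r∈ r∣d
  ... | inj₂ r∣q = All.lookup q∉ r∈ (sym (prime∣prime⇒≡ (All.lookup pqs r∈) pq r∣q))

-- Avoiding every prime factor of `c` is the same as being coprime to `c`.
sieve-primeFactors : .{{_ : NonZero c}} → sieve d (primeFactors c) c ↭ filter (d ∣?_) (totatives c)
sieve-primeFactors {c} {d} = unique∧set⇒↭ (sieve-unique d (primeFactors c) c)
  (Unique.filter⁺ (d ∣?_) (totatives-unique c)) to from
  where
  to : ∀ {k} → k ∈ sieve d (primeFactors c) c → k ∈ filter (d ∣?_) (totatives c)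
  to k∈ with k∈r , d∣k , ∤k ← ∈-sieve⁻ d (primeFactors c) c k∈
    with 1≤k , k≤c ← ∈-range⁻ k∈r =
    ∈-filter⁺ (d ∣?_)
      (∈-totatives⁺ 1≤k k≤c (∤⇒coprime λ pq q∣c → All.lookup ∤k (∈-primeFactors⁺ pq q∣c))) d∣k

  from : ∀ {k} → k ∈ filter (d ∣?_) (totatives c) → k ∈ sieve d (primeFactors c) c
  from k∈ with k∈t , d∣k ← ∈-filter⁻ (d ∣?_) {xs = totatives c} k∈
    with 1≤k , k≤c , k⊥c ← ∈-totatives⁻ c k∈t =
    ∈-sieve⁺ (∈-range⁺ 1≤k k≤c) (d∣k , All.tabulate λ q∈ q∣k →
      let pq , q∣c = ∈-primeFactors⁻ c q∈ in prime⇒∤coprime pq k⊥c q∣k q∣c)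

-- The induction is started at `d = p`; coprimality of `p` and `c` supplies its invariant, that no
-- prime factor of `c` divides `p`.
E≡length-multiples : .{{_ : NonZero c}} → Prime p → Coprime p c →
                     E c p ≡ + length (filter (p ∣?_) (totatives c))
E≡length-multiples {c} {p} pp p⊥c = trans
  (altSum≡length-sieve (primeFactors c) c p {{prime⇒nonZero pp}} (primeFactors-unique c)
    (All.tabulate λ q∈ → proj₁ (∈-primeFactors⁻ c q∈)) (All.tabulate ∤p))
  (cong +_ (↭-length sieve-primeFactors))
  where
  ∤p : ∀ {q} → q ∈ primeFactors c → q ∤ p
  ∤p q∈ q∣p with pq , q∣c ← ∈-primeFactors⁻ c q∈ = prime⇒∤coprime pq p⊥c q∣p q∣c

-- Transfer to the rationals and conclusion.

-- The normalisation inside `fromℕ` does not compute on variables, so the two sides are compared in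
-- `ℚᵘ`, where the denominators are plainly 1.
fromℕ-* : ∀ m n → fromℕ (m ℕ.* n) ≡ fromℕ m * fromℕ n
fromℕ-* m n = ℚ.toℚᵘ-injective (begin
  toℚᵘ (fromℕ (m ℕ.* n))            ≈⟨ ℚ.toℚᵘ-fromℚᵘ (int (m ℕ.* n)) ⟩
  int (m ℕ.* n)                     ≈⟨ *≡* (cong (ℤ._* + 1) (ℤ.pos-* m n)) ⟩
  int m ℚᵘ.* int n                  ≈⟨ ℚᵘ.*-cong (ℚ.toℚᵘ-fromℚᵘ (int m)) (ℚ.toℚᵘ-fromℚᵘ (int n)) ⟨
  toℚᵘ (fromℕ m) ℚᵘ.* toℚᵘ (fromℕ n) ≈⟨ ℚ.toℚᵘ-homo-* (fromℕ m) (fromℕ n) ⟨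
  toℚᵘ (fromℕ m * fromℕ n)          ∎)
  where
  open import Relation.Binary.Reasoning.Setoid ℚᵘ.≃-setoid
  int : ℕ → ℚᵘ
  int n = mkℚᵘ (+ n) 0

fromℕ-product : ∀ ns → fromℕ (product ns) ≡ ∏ℚ (map fromℕ ns)
fromℕ-product []       = refl
fromℕ-product (n ∷ ns) = trans (fromℕ-* n (product ns)) (cong (fromℕ n *_) (fromℕ-product ns))

theorem1 : (c : ℕ) → 3 ≤ c →
    fromℕ (G c) ≡ fromℕ (R c ^ (φ c / 2)) * ∏ℚ (map (λ p → p ^ℤ E c p) (coprimePrimesBelow c))
theorem1 c 3≤c = begin
  fromℕ (G c)
    ≡⟨ cong fromℕ (trans (G≡∏R 3≤c) (cong (R c ^ (φ c / 2) ℕ.*_) (∏R≡∏^ 2≤c))) ⟩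
  fromℕ (R c ^ (φ c / 2) ℕ.* product (map power ps))
    ≡⟨ fromℕ-* (R c ^ (φ c / 2)) _ ⟩
  fromℕ (R c ^ (φ c / 2)) * fromℕ (product (map power ps))
    ≡⟨ cong (fromℕ (R c ^ (φ c / 2)) *_)
         (trans (fromℕ-product (map power ps)) (cong ∏ℚ (sym (map-∘ ps)))) ⟩
  fromℕ (R c ^ (φ c / 2)) * ∏ℚ (map (fromℕ ∘ power) ps)
    ≡⟨ cong (λ xs → fromℕ (R c ^ (φ c / 2)) * ∏ℚ xs) (map-cong-local (All.tabulate power≡)) ⟩
  fromℕ (R c ^ (φ c / 2)) * ∏ℚ (map (λ p → p ^ℤ E c p) ps) ∎
  where
  open ≡-Reasoning
  ps : List ℕ
  ps = coprimePrimesBelow c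

  power : ℕ → ℕ
  power p = p ^ length (filter (p ∣?_) (totatives c))

  2≤c : 2 ≤ c
  2≤c = ℕ.≤-trans (ℕ.n≤1+n 2) 3≤c

  -- The exponent `E c p` is a count, hence of the form `+ n`, so after rewriting only the first
  -- clause of `_^ℤ_` applies and it reduces to `fromℕ` of a natural power.
  power≡ : ∀ {p} → p ∈ ps → fromℕ (power p) ≡ p ^ℤ E c p
  power≡ {p} p∈ with pp , p⊥c ← ∈-coprimePrimesBelow⁻ c p∈ =
    cong (p ^ℤ_) (sym (E≡length-multiples {{>-nonZero (ℕ.≤-trans (ℕ.n≤1+n 1) 2≤c)}} pp p⊥c))
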